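{- Let $(\Gamma,<_1,<_2,<_3)$ be a primitive homogeneous 3-dimensional permutation structure. Then there is a nonempty set $S\subseteq\{1,2,3\}$ such that each $<_j$ ($j=1,2,3$) equals $<_i$ or $<_i^{opp}$ for some $i\in S$, and $(\Gamma,(<_i)_{i\in S})$ is the generic $|S|$-dimensional permutation structure. (That is, $\Gamma$ is obtained by identifying certain orders up to reversal and taking the generic structure.)
   Context: A 3-dimensional permutation structure is $(\Gamma,<_1,<_2,<_3)$ with each $<_i$ a linear order; homogeneous means countably infinite with every isomorphism between finite substructures extending to an automorphism. Primitive means there is no $\emptyset$-definable equivalence relation other than equality and the total relation. The generic $k$-dimensional permutation structure is the Fraïssé limit of the class of all finite structures with $k$ linear orders. $<^{opp}$ denotes the reverse of $<$. -}

module Defs where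

open import Data.Nat using (ℕ; suc)
open import Data.Fin using (Fin; zero; suc)
open import Data.Product using (Σ; _×_)
open import Data.Sum using (_⊎_)
open import Data.Empty using (⊥)
open import Relation.Nullary using (¬_)
open import Relation.Binary.PropositionalEquality using (_≡_)
open import Relation.Binary.Structures using (IsEquivalence)
open import Function.Bundles using (_↔_; _⇔_; Inverse)
open import Function.Definitions using (Injective)

IsStrictLinear : {A : Set} → (A → A → Set) → Set
IsStrictLinear {A} R =
  (∀ x → ¬ R x x) × (∀ x y z → R x y → R y z → R x z) × (∀ x y → R x y ⊎ x ≡ y ⊎ R y x)

record PermStr (k : ℕ) : Set₁ where
  field
    Carrier : Set
    lt      : Fin k → Carrier → Carrier → Set
    linear  : ∀ i → IsStrictLinear (lt i)

open PermStr public

Embedding : {k : ℕ} → PermStr k → PermStr k → Set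
Embedding {k} A B =
  Σ (Carrier A → Carrier B) λ f →
    Injective _≡_ _≡_ f × (∀ i x y → lt A i x y ⇔ lt B i (f x) (f y))

Automorphism : {k : ℕ} → PermStr k → Set
Automorphism {k} M =
  Σ (Carrier M ↔ Carrier M) λ σ →
    ∀ i x y → lt M i x y ⇔ lt M i (Inverse.to σ x) (Inverse.to σ y)

CountablyInfinite : {k : ℕ} → PermStr k → Set
CountablyInfinite M = Carrier M ↔ ℕ

-- Homogeneity: countably infinite, and every isomorphism between finite
-- substructures extends to an automorphism.  A finite substructure is the
-- image of an injective tuple a : Fin n → Carrier; an isomorphism onto
-- another finite substructure sends a p to b p, where b is injective and
-- the orders agree on a and b.
Homogeneous : {k : ℕ} → PermStr k → Set
Homogeneous {k} M =
  CountablyInfinite M ×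
  (∀ (n : ℕ) (a b : Fin n → Carrier M) →
     Injective _≡_ _≡_ a → Injective _≡_ _≡_ b →
     (∀ i p q → lt M i (a p) (a q) ⇔ lt M i (b p) (b q)) →
     Σ (Automorphism M) λ σ → ∀ p → Inverse.to (Σ.proj₁ σ) (a p) ≡ b p)

IsFinite : {k : ℕ} → PermStr k → Set
IsFinite A = Σ ℕ λ n → Carrier A ↔ Fin n

-- The generic k-dimensional permutation structure = Fraïssé limit of the
-- class of all finite k-dimensional permutation structures, characterised
-- (Fraïssé) as the countable homogeneous structure whose age is that class,
-- i.e. into which every finite k-dimensional permutation structure embeds.
IsGeneric : {k : ℕ} → PermStr k → Set₁
IsGeneric {k} M = Homogeneous M × ((A : PermStr k) → IsFinite A → Embedding A M)

data Formula (k n : ℕ) : Set where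
  rel    : Fin k → Fin n → Fin n → Formula k n
  equ    : Fin n → Fin n → Formula k n
  falsum : Formula k n
  _⇒_    : Formula k n → Formula k n → Formula k n
  _∧_    : Formula k n → Formula k n → Formula k n
  _∨_    : Formula k n → Formula k n → Formula k n
  ∀'     : Formula k (suc n) → Formula k n
  ∃'     : Formula k (suc n) → Formula k n

extend : {A : Set} {n : ℕ} → A → (Fin n → A) → Fin (suc n) → A
extend x env zero    = x
extend x env (suc i) = env i

Sat : {k n : ℕ} (M : PermStr k) → (Fin n → Carrier M) → Formula k n → Set
Sat M env (rel i p q) = lt M i (env p) (env q)
Sat M env (equ p q)   = env p ≡ env q
Sat M env falsum      = ⊥
Sat M env (φ ⇒ ψ)     = Sat M env φ → Sat M env ψ
Sat M env (φ ∧ ψ)     = Sat M env φ × Sat M env ψ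
Sat M env (φ ∨ ψ)     = Sat M env φ ⊎ Sat M env ψ
Sat M env (∀' φ)      = ∀ x → Sat M (extend x env) φ
Sat M env (∃' φ)      = Σ (Carrier M) λ x → Sat M (extend x env) φ

pair : {A : Set} → A → A → Fin 2 → A
pair x y zero       = x
pair x y (suc zero) = y

Defined : {k : ℕ} (M : PermStr k) → Formula k 2 → Carrier M → Carrier M → Set
Defined M φ x y = Sat M (pair x y) φ

Primitive : {k : ℕ} → PermStr k → Set
Primitive {k} M =
  ∀ (φ : Formula k 2) → IsEquivalence (Defined M φ) →
    (∀ x y → Defined M φ x y ⇔ x ≡ y) ⊎ (∀ x y → Defined M φ x y)

reduct : {k m : ℕ} → PermStr k → (Fin m → Fin k) → PermStr m
reduct M e = record
  { Carrier = Carrier M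
  ; lt      = λ p → lt M (e p)
  ; linear  = λ p → linear M (e p)
  }

SameRel : {A : Set} → (A → A → Set) → (A → A → Set) → Set
SameRel R R' = ∀ x y → R x y ⇔ R' x y

OppositeRel : {A : Set} → (A → A → Set) → (A → A → Set) → Set
OppositeRel R R' = ∀ x y → R x y ⇔ R' y x

{-# OPTIONS --safe #-}

-- By homogeneity the orbits on pairs of distinct points are described by sign vectors ("types"), so there
-- are finitely many, and each type is a transitive relation, being an intersection of orders.
--
-- The heart of the matter is that no point a defines a proper cut c(a) > a in any of the orders.
-- By primitivity c would be injective.  It is not monotone, since iterating it would give infinitely many
-- definable cuts.  If a < b < c(a) never had c(a) < c(b), the intervals [a, c(a)) would form a laminar
-- family, hence a tree, and the linear orders cannot tell the branching pattern of a chain of three points.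
-- Otherwise transitivity of types yields a smaller cut, and this descent cannot go on forever.
--
-- Hence every type is cofinal and coinitial over each point in each order.  For orders that differ even
-- up to reversal, this shows that every interval of one order contains points that are arbitrarily high
-- in all the others.  Such points serve as separators in amalgamation: to place two points u, v over a
-- finite set, add for each order a point between u and v in that order and above everything in
-- the others.  Both halves of the diagram are realised, and the separators force the desired amalgam.

module Submission where

open import Defs
open import Data.Nat using (ℕ; zero; suc; _^_; _≤_; z≤n; s≤s)
open import Data.Fin using (Fin; zero; suc; finToFun; funToFin)
open import Data.Fin.Properties using (finToFun-funToFin; suc-injective; _≟_)
open import Data.Fin.Subset using (Subset; _⊂_; _⊃_; _∈_)
open import Data.Fin.Subset.Induction using (⊂-wellFounded; ⊃-wellFounded)
open import Data.Vec using (tabulate)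
open import Data.Vec.Properties using (lookup∘tabulate; []=⇒lookup; lookup⇒[]=)
open import Data.Product using (Σ; _×_; _,_; proj₁; proj₂; map₂)
open import Data.Sum using (_⊎_; inj₁; inj₂; [_,_]′; swap) renaming (map to map⊎)
open import Data.Empty using (⊥; ⊥-elim)
open import Function.Base using (_∘_; case_of_; flip; id)
open import Function.Bundles using (_↔_; _⇔_; Inverse; Equivalence; mk⇔)
open import Function.Definitions using (Injective)
open import Function.Properties.Inverse using (↔-sym; ↔-trans; ↔-refl)
open import Induction.WellFounded using (Acc; acc)
open import Relation.Nullary using (¬_; Dec; yes; no; does)
open import Relation.Nullary.Decidable using (decidable-stable; dec-true)
open import Relation.Binary.PropositionalEquality using (_≡_; _≢_; refl; sym; trans; cong; subst; subst₂; ≢-sym)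
open import Relation.Binary.Structures using (IsEquivalence)

open Equivalence using (to; from)

private variable
  k n : ℕ
  A : Set

-- Signed orders, automorphisms and invariant relations.

Rel₂ : Set → Set₁
Rel₂ A = A → A → Set

sgn : Fin 2 → Rel₂ A → Rel₂ A
sgn zero       R x y = R x y
sgn (suc zero) R x y = R y x

flip-linear : {R : Rel₂ A} → IsStrictLinear R → IsStrictLinear (flip R)
flip-linear (irr , tr , cmp) =
  irr , (λ x y z yx zy → tr z y x zy yx) , λ x y → map⊎ id (map⊎ sym id) (cmp y x)

sgn-linear : ∀ s {R : Rel₂ A} → IsStrictLinear R → IsStrictLinear (sgn s R)
sgn-linear zero       lin = lin
sgn-linear (suc zero) lin = flip-linear lin

module StrictLinear {_<_ : Rel₂ A} (lin : IsStrictLinear _<_) where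
  irrefl : ∀ {x} → ¬ x < x
  irrefl {x} = proj₁ lin x

  <-trans : ∀ {x y z} → x < y → y < z → x < z
  <-trans {x} {y} {z} = proj₁ (proj₂ lin) x y z

  compare : ∀ x y → x < y ⊎ x ≡ y ⊎ y < x
  compare = proj₂ (proj₂ lin)

  infix 4 _≼_
  _≼_ : Rel₂ A
  x ≼ y = x < y ⊎ x ≡ y

  <-≼-trans : ∀ {x y z} → x < y → y ≼ z → x < z
  <-≼-trans x<y (inj₁ y<z)  = <-trans x<y y<z
  <-≼-trans x<y (inj₂ refl) = x<y

  ≼-<-trans : ∀ {x y z} → x ≼ y → y < z → x < z
  ≼-<-trans (inj₁ x<y)  y<z = <-trans x<y y<z
  ≼-<-trans (inj₂ refl) y<z = y<z

  <⇒≢ : ∀ {x y} → x < y → x ≢ y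
  <⇒≢ x<y refl = irrefl x<y

  ≢⇒<> : ∀ {x y} → x ≢ y → x < y ⊎ y < x
  ≢⇒<> {x} {y} x≢y with compare x y
  ... | inj₁ x<y        = inj₁ x<y
  ... | inj₂ (inj₁ x≡y) = ⊥-elim (x≢y x≡y)
  ... | inj₂ (inj₂ y<x) = inj₂ y<x

act : {M : PermStr k} → Automorphism M → Carrier M → Carrier M
act (σ , _) = Inverse.to σ

inverse : {M : PermStr k} → Automorphism M → Automorphism M
inverse {M = M} (σ , pres) = ↔-sym σ , λ i x y → mk⇔
  (λ x<y → from (pres i _ _) (subst₂ (lt M i) (sym (Inverse.strictlyInverseˡ σ x)) (sym (Inverse.strictlyInverseˡ σ y)) x<y))
  (λ x<y → subst₂ (lt M i) (Inverse.strictlyInverseˡ σ x) (Inverse.strictlyInverseˡ σ y) (to (pres i _ _) x<y))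

compose : (M : PermStr k) → Automorphism M → Automorphism M → Automorphism M
compose M (σ , p) (τ , q) = ↔-trans σ τ , λ i x y → mk⇔
  (λ x<y → to (q i _ _) (to (p i x y) x<y)) (λ x<y → from (p i x y) (from (q i _ _) x<y))

act-inverse : {M : PermStr k} (σ : Automorphism M) → ∀ x → act {M = M} σ (act {M = M} (inverse {M = M} σ) x) ≡ x
act-inverse (σ , _) = Inverse.strictlyInverseˡ σ

inverse-act : {M : PermStr k} (σ : Automorphism M) → ∀ x → act {M = M} (inverse {M = M} σ) (act {M = M} σ x) ≡ x
inverse-act (σ , _) = Inverse.strictlyInverseʳ σ

Extendible : PermStr k → Set
Extendible M = ∀ n (a b : Fin n → Carrier M) → Injective _≡_ _≡_ a → Injective _≡_ _≡_ b →
  (∀ i p q → lt M i (a p) (a q) ⇔ lt M i (b p) (b q)) →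
  Σ (Automorphism M) λ σ → ∀ p → act {M = M} σ (a p) ≡ b p

Invariant : (M : PermStr k) → Rel₂ (Carrier M) → Set
Invariant M R = ∀ (σ : Automorphism M) x y → R x y → R (act {M = M} σ x) (act {M = M} σ y)

-- Quantifying over invariant instead of definable equivalences allows relations built from cuts to
-- be used without writing formulas.
InvariantlyPrimitive : PermStr k → Set₁
InvariantlyPrimitive M = ∀ E → IsEquivalence E → Invariant M E →
  (∀ x y → E x y → x ≡ y) ⊎ (∀ x y → E x y)

-- Classical reasoning over finite index sets.

module Classical (lem : ∀ (P : Set) → Dec P) where

  byContradiction : {P : Set} → ¬ ¬ P → P
  byContradiction {P} = decidable-stable (lem P)

  ¬∀⇒∃¬ : {P : A → Set} → ¬ (∀ x → P x) → Σ A λ x → ¬ P x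
  ¬∀⇒∃¬ {P = P} ¬∀ = byContradiction λ ¬∃ → ¬∀ λ x → byContradiction λ ¬p → ¬∃ (x , ¬p)

  ⊈⇒∃ : {P Q : A → Set} → ¬ (∀ x → P x → Q x) → Σ A λ x → P x × ¬ Q x
  ⊈⇒∃ ¬⊆ = let x , ¬pq = ¬∀⇒∃¬ ¬⊆ in
    x , byContradiction (λ ¬p → ¬pq λ p → ⊥-elim (¬p p)) , λ q → ¬pq λ _ → q

  comprehension : (Fin n → Set) → Subset n
  comprehension P = tabulate (λ t → does (lem (P t)))

  ∈-comprehension⁺ : {P : Fin n → Set} → ∀ {t} → P t → t ∈ comprehension P
  ∈-comprehension⁺ {P = P} {t} p =
    lookup⇒[]= t _ (trans (lookup∘tabulate _ t) (dec-true (lem (P t)) p))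

  ∈-comprehension⁻ : {P : Fin n → Set} → ∀ {t} → t ∈ comprehension P → P t
  ∈-comprehension⁻ {P = P} {t} t∈ with lem (P t) | trans (sym (lookup∘tabulate (λ u → does (lem (P u))) t)) ([]=⇒lookup t∈)
  ... | yes p | _  = p
  ... | no _  | ()

  comprehension-⊂ : {P Q : Fin n → Set} → (∀ t → P t → Q t) → ∀ {t} → Q t → ¬ P t → comprehension P ⊂ comprehension Q
  comprehension-⊂ P⊆Q q ¬p =
    (λ t∈ → ∈-comprehension⁺ (P⊆Q _ (∈-comprehension⁻ t∈))) ,
    _ , ∈-comprehension⁺ q , λ t∈ → ¬p (∈-comprehension⁻ t∈)

  -- If `Q zero` fails at `b₀`, it fails at every smaller `b`, so the other indices serve there;
  -- above `b₀`, a witness for `b₀` is carried upward. Induction on `n` finishes.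
  pigeonhole : {_<_ : Rel₂ A} → IsStrictLinear _<_ → A → ∀ {n} (Q : Fin n → A → Set) →
    (∀ t {b c} → b < c → Q t b → Q t c) → (∀ b → Σ (Fin n) λ t → Q t b) → Σ (Fin n) λ t → ∀ b → Q t b
  pigeonhole lin a {zero} Q mono some with some a
  ... | () , _
  pigeonhole {A = A} {_<_ = _<_} lin a {suc n} Q mono some with lem (∀ b → Q zero b)
  ... | yes all₀ = zero , all₀
  ... | no ¬all₀ =
    let t , all = pigeonhole lin a (Q ∘ suc) (mono ∘ suc) tail in suc t , all
    where
      open StrictLinear lin
      b₀  = proj₁ (¬∀⇒∃¬ ¬all₀)
      ¬q₀ = proj₂ (¬∀⇒∃¬ ¬all₀)
      below : ∀ b → ¬ Q zero b → Σ (Fin n) λ t → Q (suc t) b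
      below b ¬q with some b
      ... | zero  , q = ⊥-elim (¬q q)
      ... | suc t , q = t , q
      tail : ∀ b → Σ (Fin n) λ t → Q (suc t) b
      tail b with compare b b₀
      ... | inj₁ b<b₀          = below b λ q → ¬q₀ (mono zero b<b₀ q)
      ... | inj₂ (inj₁ refl)   = below b ¬q₀
      ... | inj₂ (inj₂ b₀<b)   = map₂ (mono (suc _) b₀<b) (below b₀ ¬q₀)

  -- Types of pairs and extension of finite isomorphisms.

  module Types (M : PermStr (suc k)) (ext : Extendible M) where
    C : Set
    C = Carrier M

    Aut : Set
    Aut = Automorphism M

    infixr 22 _·_
    _·_ : Aut → C → C
    _·_ = act {M = M}

    infix 25 _⁻¹
    _⁻¹ : Aut → Aut
    _⁻¹ = inverse {M = M}

    Inv : Rel₂ C → Set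
    Inv = Invariant M

    module Lt (i : Fin (suc k)) = StrictLinear (linear M i)

    Agree : C → C → C → C → Set
    Agree x y x′ y′ = ∀ i → (lt M i x y × lt M i x′ y′) ⊎ (lt M i y x × lt M i y′ x′)

    Iso : (a b : Fin n → C) → Set
    Iso a b = ∀ p q → p ≢ q → Agree (a p) (a q) (b p) (b q)

    Iso-sym : {a b : Fin n → C} → Iso a b → Iso b a
    Iso-sym iso p q p≢q i = map⊎ (λ (u , v) → v , u) (λ (u , v) → v , u) (iso p q p≢q i)

    Iso⇒injective : {a b : Fin n → C} → Iso a b → Injective _≡_ _≡_ a
    Iso⇒injective {a = a} iso {p} {q} ap≡aq with p ≟ q
    ... | yes p≡q = p≡q
    ... | no p≢q with iso p q p≢q zero
    ...   | inj₁ (u , _) = ⊥-elim (Lt.irrefl zero (subst (λ c → lt M zero c (a q)) ap≡aq u))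
    ...   | inj₂ (u , _) = ⊥-elim (Lt.irrefl zero (subst (λ c → lt M zero (a q) c) ap≡aq u))

    Iso⇒preserves : {a b : Fin n → C} → Iso a b → ∀ i p q → lt M i (a p) (a q) → lt M i (b p) (b q)
    Iso⇒preserves iso i p q u with p ≟ q
    ... | yes refl = ⊥-elim (Lt.irrefl i u)
    ... | no p≢q with iso p q p≢q i
    ...   | inj₁ (_ , v) = v
    ...   | inj₂ (w , _) = ⊥-elim (Lt.irrefl i (Lt.<-trans i u w))

    extendIso : {a b : Fin n → C} → Iso a b → Σ Aut λ σ → ∀ p → σ · a p ≡ b p
    extendIso iso = ext _ _ _ (Iso⇒injective iso) (Iso⇒injective (Iso-sym iso))
      λ i p q → mk⇔ (Iso⇒preserves iso i p q) (Iso⇒preserves (Iso-sym iso) i p q)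

    Iso-nil : {a b : Fin 0 → C} → Iso a b
    Iso-nil ()

    Iso-cons : ∀ {x y} {a b : Fin n → C} → (∀ p → Agree x (a p) y (b p)) → Iso a b → Iso (extend x a) (extend y b)
    Iso-cons agr iso zero    zero    p≢q = ⊥-elim (p≢q refl)
    Iso-cons agr iso zero    (suc q) _   = agr q
    Iso-cons agr iso (suc p) zero    _   = λ i → swap (agr p i)
    Iso-cons agr iso (suc p) (suc q) p≢q = iso p q (p≢q ∘ cong suc)

    empty : Fin 0 → C
    empty ()

    extend₁ : ∀ x x′ → Σ Aut λ σ → σ · x ≡ x′
    extend₁ x x′ = let σ , h = extendIso (Iso-cons {x = x} {y = x′} (λ ()) (Iso-nil {a = empty} {b = empty})) in
      σ , h zero

    extend₂ : ∀ {x y x′ y′} → Agree x y x′ y′ → Σ Aut λ σ → σ · x ≡ x′ × σ · y ≡ y′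
    extend₂ {x} {y} {x′} {y′} agr =
      let σ , h = extendIso (Iso-cons {x = x} {y = x′} (λ { zero → agr })
                    (Iso-cons {x = y} {y = y′} (λ ()) (Iso-nil {a = empty} {b = empty}))) in
      σ , h zero , h (suc zero)

    extend₃ : ∀ {x y z x′ y′ z′} → Agree x y x′ y′ → Agree x z x′ z′ → Agree y z y′ z′ →
      Σ Aut λ σ → σ · x ≡ x′ × σ · y ≡ y′ × σ · z ≡ z′
    extend₃ {x} {y} {z} {x′} {y′} {z′} xy xz yz =
      let σ , h = extendIso (Iso-cons {x = x} {y = x′} (λ { zero → xy ; (suc zero) → xz })
                    (Iso-cons {x = y} {y = y′} (λ { zero → yz })
                      (Iso-cons {x = z} {y = z′} (λ ()) (Iso-nil {a = empty} {b = empty})))) in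
      σ , h zero , h (suc zero) , h (suc (suc zero))

    Inv-¬ : {R : Rel₂ C} → Inv R → Inv λ x y → ¬ R x y
    Inv-¬ {R} inv σ x y ¬r r = ¬r (subst₂ R (inverse-act {M = M} σ x) (inverse-act {M = M} σ y) (inv (σ ⁻¹) _ _ r))

    Inv-× : {R S : Rel₂ C} → Inv R → Inv S → Inv λ x y → R x y × S x y
    Inv-× inv inv′ σ x y (r , s) = inv σ x y r , inv′ σ x y s

    Inv-flip : {R : Rel₂ C} → Inv R → Inv (flip R)
    Inv-flip inv σ x y = inv σ y x

    Inv-lt : ∀ i → Inv (lt M i)
    Inv-lt i σ x y = to (proj₂ σ i x y)

    sgn-inv : ∀ i s → Inv (sgn s (lt M i))
    sgn-inv i zero       = Inv-lt i
    sgn-inv i (suc zero) = Inv-flip (Inv-lt i)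

    ∃-transport : {R : Rel₂ C} → Inv R → ∀ {x y} → R x y → ∀ x′ → Σ C λ y′ → R x′ y′
    ∃-transport {R} inv {x} {y} r x′ = let σ , σx≡x′ = extend₁ x x′ in
      σ · y , subst (λ c → R c (σ · y)) σx≡x′ (inv σ x y r)

    HasType : Fin (2 ^ suc k) → Rel₂ C
    HasType t x y = ∀ i → sgn (finToFun t i) (lt M i) x y

    HasType-inv : ∀ t → Inv (HasType t)
    HasType-inv t σ x y h i = sgn-inv i (finToFun t i) σ x y (h i)

    HasType-trans : ∀ t {x y z} → HasType t x y → HasType t y z → HasType t x z
    HasType-trans t u v i with finToFun {2} {suc k} t i | u i | v i
    ... | zero     | a | b = Lt.<-trans i a b
    ... | suc zero | a | b = Lt.<-trans i b a

    HasType-agree : ∀ t {x y x′ y′} → HasType t x y → HasType t x′ y′ → Agree x y x′ y′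
    HasType-agree t u v i with finToFun {2} {suc k} t i | u i | v i
    ... | zero     | a | b = inj₁ (a , b)
    ... | suc zero | a | b = inj₂ (a , b)

    -- By homogeneity the pairs of one type form a single orbit, so an invariant relation contains
    -- all of them or none.
    HasType-determines : {R : Rel₂ C} → Inv R → ∀ t {x y x′ y′} → HasType t x y → HasType t x′ y′ → R x y → R x′ y′
    HasType-determines {R} inv t u v r = let σ , p , q = extend₂ (HasType-agree t u v) in
      subst₂ R p q (inv σ _ _ r)

    typeOf : ∀ {x y} → x ≢ y → Σ _ λ t → HasType t x y
    typeOf {x} {y} x≢y = funToFin s , λ i → subst (λ j → sgn j (lt M i) x y) (sym (finToFun-funToFin s i)) (s-correct i)
      where
        choice : ∀ i → Σ (Fin 2) λ j → sgn j (lt M i) x y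
        choice i = [ (λ u → zero , u) , (λ u → suc zero , u) ]′ (Lt.≢⇒<> i x≢y)
        s : Fin (suc k) → Fin 2
        s = proj₁ ∘ choice
        s-correct : ∀ i → sgn (s i) (lt M i) x y
        s-correct = proj₂ ∘ choice

    -- A finite measure of invariant relations, along which inductions on growing and on shrinking
    -- cuts terminate.
    typesOf : Rel₂ C → Subset (2 ^ suc k)
    typesOf R = comprehension λ t → Σ C λ x → Σ C λ y → HasType t x y × R x y

    typesOf-⊂ : {R S : Rel₂ C} → Inv R → (∀ x y → R x y → S x y) →
      ∀ {x y} → x ≢ y → S x y → ¬ R x y → typesOf R ⊂ typesOf S
    typesOf-⊂ inv R⊆S x≢y s ¬r = let t , h = typeOf x≢y in
      comprehension-⊂ (λ { _ (x , y , h , r) → x , y , h , R⊆S x y r }) (_ , _ , h , s)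
        λ (x′ , y′ , h′ , r) → ¬r (HasType-determines inv t h′ h r)

  -- Invariant cuts and their impossibility.

  module Cuts (M : PermStr (suc k)) (ext : Extendible M) (prim : InvariantlyPrimitive M)
              {_<_ : Rel₂ (Carrier M)} (lin : IsStrictLinear _<_) (<-inv : Invariant M _<_) (a₀ : Carrier M) where
    open Types M ext
    open StrictLinear lin

    -- R a encodes a proper cut c(a) > a of (M, <) definable from a: R a x means x < c(a).
    record Cut (R : Rel₂ C) : Set where
      field
        inv    : Inv R
        down   : ∀ {a x y} → y < x → R a x → R a y
        above  : ∀ a → Σ C λ x → a < x × R a x
        proper : ∀ a → Σ C λ x → ¬ R a x

      self : ∀ a → R a a
      self a = let x , a<x , r = above a in down a<x r

      ∉⇒> : ∀ {a x y} → R a x → ¬ R a y → x < y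
      ∉⇒> {a} {x} {y} r ¬r with compare x y
      ... | inj₁ x<y         = x<y
      ... | inj₂ (inj₁ refl) = ⊥-elim (¬r r)
      ... | inj₂ (inj₂ y<x)  = ⊥-elim (¬r (down y<x r))

      -- Having the same cut is an invariant equivalence. It is not total, since each point lies
      -- below its own cut but not all points lie below the cut of `a`; so primitivity makes it
      -- equality.
      injective : ∀ {a b} → (∀ x → R a x → R b x) → (∀ x → R b x → R a x) → a ≡ b
      injective {a} {b} ab ba with prim E E-equiv E-inv
        where
          E : Rel₂ C
          E u v = (∀ x → R u x → R v x) × (∀ x → R v x → R u x)
          E-equiv : IsEquivalence E
          E-equiv = record
            { refl  = (λ _ r → r) , (λ _ r → r)
            ; sym   = λ (f , g) → g , f
            ; trans = λ (f , g) (f′ , g′) → (λ x → f′ x ∘ f x) , (λ x → g x ∘ g′ x) }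
          half : ∀ σ {u v} → (∀ x → R u x → R v x) → ∀ x → R (σ · u) x → R (σ · v) x
          half σ {u} {v} f x r = subst (R (σ · v)) (act-inverse {M = M} σ x) (inv σ v _
            (f _ (subst (λ c → R c (σ ⁻¹ · x)) (inverse-act {M = M} σ u) (inv (σ ⁻¹) _ _ r))))
          E-inv : Inv E
          E-inv σ u v (f , g) = half σ f , half σ g
      ... | inj₁ trivial = trivial a b (ab , ba)
      ... | inj₂ total   = let x , ¬r = proper a in ⊥-elim (¬r (proj₂ (total a x) x (self x)))

      upper : ∀ x → Σ C λ y → x < y
      upper x = map₂ proj₁ (above x)

      lower : ∀ y → Σ C λ x → x < y
      lower y = ∃-transport (Inv-flip <-inv) (proj₂ (upper y)) y

    open Cut

    -- Composing a monotone cut with itself gives a strictly larger one, but there are finitely many types.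
    no-monotone : ∀ R → Cut R → (∀ {a b} → a < b → ∀ x → R a x → R b x) → Acc _⊃_ (typesOf R) → ⊥
    no-monotone R cut mono (acc rec) = no-monotone R² cut² mono² (rec grows)
      where
        R² : Rel₂ C
        R² a x = Σ C λ y → R a y × R y x
        R⊆R² : ∀ a x → R a x → R² a x
        R⊆R² a x r = a , self cut a , r
        cut² : Cut R²
        cut² .inv σ a x (y , r , s) = σ · y , inv cut σ a y r , inv cut σ y x s
        cut² .down z<x (y , r , s) = y , r , down cut z<x s
        cut² .above a = map₂ (map₂ (R⊆R² a _)) (above cut a)
        cut² .proper a =
          let z , ¬r = proper cut a
              u , ¬s = proper cut z
          in u , λ (y , r , s) → ¬s (mono (∉⇒> cut r ¬r) u s)
        mono² : ∀ {a b} → a < b → ∀ x → R² a x → R² b x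
        mono² a<b x (y , r , s) = y , mono a<b y r , s
        grows : typesOf R ⊂ typesOf R²
        grows =
          -- Distinct points have distinct cuts, so the larger cut of a `y` above `a₀` contains a
          -- point outside `R a₀`.
          let y , a₀<y , r = above cut a₀
              x , s , ¬r = ⊈⇒∃ λ y⊆a → irrefl (subst (a₀ <_) (injective cut y⊆a (mono a₀<y)) a₀<y)
          in typesOf-⊂ (inv cut) R⊆R² (<⇒≢ (∉⇒> cut (self cut a₀) ¬r)) (y , r , s) ¬r

    -- Otherwise the supremum of the cuts of all points up to a given one is a proper monotone cut,
    -- against `no-monotone`.
    ∃-below-reaching : ∀ {R} → Cut R → ∀ a b → Σ C λ y → y < a × R y b
    ∃-below-reaching {R} cut a b with lem (Σ C λ y → y < a × R y b)
    ... | yes found = found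
    ... | no ¬found = ⊥-elim (no-monotone R′ cut′ mono′ (⊃-wellFounded _))
      where
        R′ : Rel₂ C
        R′ a x = Σ C λ y → y ≼ a × R y x
        R′-inv : Inv R′
        R′-inv σ a x (y , y≼a , r) = σ · y , map⊎ (<-inv σ y a) (cong (σ ·_)) y≼a , inv cut σ y x r
        -- `R′` admits `y` equal to its argument, so properness is witnessed at a point strictly
        -- below `a`.
        a′ : Σ C λ a′ → a′ < a
        a′ = lower cut a
        ¬R′ : ¬ R′ (proj₁ a′) b
        ¬R′ (y , y≼a′ , r) = ¬found (y , ≼-<-trans y≼a′ (proj₂ a′) , r)
        cut′ : Cut R′
        cut′ .inv = R′-inv
        cut′ .down z<x (y , y≼a , r) = y , y≼a , down cut z<x r
        cut′ .above a = map₂ (map₂ λ r → a , inj₂ refl , r) (above cut a)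
        cut′ .proper = ∃-transport (Inv-¬ R′-inv) ¬R′
        mono′ : ∀ {a b} → a < b → ∀ x → R′ a x → R′ b x
        mono′ a<b x (y , y≼a , r) = y , inj₁ (≼-<-trans y≼a a<b) , r

    UnboundedAbove UnboundedBelow : Fin (2 ^ suc k) → Set
    UnboundedAbove t = ∀ y b → Σ C λ z → HasType t y z × b < z
    UnboundedBelow t = ∀ y b → Σ C λ x → HasType t x y × x < b

    Disjoint : Fin (2 ^ suc k) → Rel₂ C → Set
    Disjoint t R = ∀ {x y} → HasType t x y → ¬ R x y

    -- The intervals [a, c(a)) cannot form a laminar family: in a chain x, y, z of type t, some interval
    -- contains x and y but not z, and, by homogeneity, another one contains y and z but not x.
    no-laminar : ∀ {R} → Cut R → ∀ {t} → UnboundedAbove t → UnboundedBelow t → Disjoint t R →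
      ¬ (∀ {a b} → a < b → R a b → ∀ x → R b x → R a x)
    no-laminar {R} cut {t} unb⁺ unb⁻ disj laminar =
      let y = a₀
          x , txy , _ = unb⁻ y y
          w , w<x , Rwy = ∃-below-reaching cut x y
          b , ¬Rwb = proper cut w
          z , tyz , b<z = unb⁺ y b
          z′ , ty′z′ , _ = unb⁺ y y
          w′ , w′<y′ , Rw′z′ = ∃-below-reaching cut y z′
          x′ , tx′y′ , x′<w′ = unb⁻ y w′
          σ , σx , σy , σz = extend₃ (HasType-agree t tx′y′ txy)
            (HasType-agree t (HasType-trans t tx′y′ ty′z′) (HasType-trans t txy tyz))
            (HasType-agree t ty′z′ tyz)
          v   = σ · w′
          v<y = subst (v <_) σy (<-inv σ _ _ w′<y′)
          Rvz = subst (R v) σz (inv cut σ _ _ Rw′z′)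
          x<v = subst (_< v) σx (<-inv σ _ _ x′<w′)
          Rwz = laminar (<-trans w<x x<v) (down cut v<y Rwy) z Rvz
      in ¬Rwb (down cut b<z Rwz)

    -- The down-closure of the points of type `t` over `a`: the cut at their supremum.
    cutOf : Fin (2 ^ suc k) → Rel₂ C
    cutOf t a x = Σ C λ z → HasType t a z × x ≼ z

    cutOf-inv : ∀ t → Inv (cutOf t)
    cutOf-inv t σ a x (z , h , x≼z) = σ · z , HasType-inv t σ a z h , map⊎ (<-inv σ x z) (cong (σ ·_)) x≼z

    cutOf-isCut : ∀ t {a b a′ x} → HasType t a b → a < b → ¬ cutOf t a′ x → Cut (cutOf t)
    cutOf-isCut t h a<b ¬c .inv = cutOf-inv t
    cutOf-isCut t h a<b ¬c .down y<x (z , h′ , x≼z) = z , h′ , inj₁ (<-≼-trans y<x x≼z)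
    cutOf-isCut t h a<b ¬c .above a′ =
      let b′ , h′ , a′<b′ = ∃-transport (Inv-× (HasType-inv t) <-inv) (h , a<b) a′ in
      b′ , a′<b′ , b′ , h′ , inj₂ refl
    cutOf-isCut t h a<b ¬c .proper = ∃-transport (Inv-¬ (cutOf-inv t)) ¬c

    -- If c(a) < c(b) for some b of type q over a with a < b < c(a), then the supremum of the elements
    -- of type q over a is a smaller cut: types are transitive, so sup q(b) ≤ sup q(a) ≤ c(a) < c(b).
    descent : ∀ {t} → UnboundedAbove t → UnboundedBelow t → ∀ R → Cut R → Disjoint t R → Acc _⊂_ (typesOf R) → ⊥
    descent {t} unb⁺ unb⁻ R cut disj (acc rec) =
      no-laminar cut unb⁺ unb⁻ disj λ {a} {b} a<b r → byContradiction λ b⊈a →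
        let x , s , ¬r = ⊈⇒∃ b⊈a
            q , h = typeOf (<⇒≢ a<b)
            q⊆R : ∀ u v → cutOf q u v → R u v
            q⊆R u v (z , h′ , v≼z) = ≼-closed v≼z (HasType-determines (inv cut) q h h′ r)
            ¬s : ¬ cutOf q b x
            ¬s (z , h′ , x≼z) = ¬r (≼-closed x≼z (HasType-determines (inv cut) q h (HasType-trans q h h′) r))
        in descent unb⁺ unb⁻ (cutOf q) (cutOf-isCut q h a<b ¬s) (λ h′ c → disj h′ (q⊆R _ _ c))
             (rec (typesOf-⊂ (cutOf-inv q) q⊆R (<⇒≢ (∉⇒> cut r ¬r)) s ¬s))
      where
        ≼-closed : ∀ {a x y} → x ≼ y → R a y → R a x
        ≼-closed (inj₁ x<y)  = down cut x<y
        ≼-closed (inj₂ refl) = id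

    -- Points `x` with `a₀` outside `R x` occur arbitrarily far down, so by `pigeonhole` those of a
    -- single type do. By homogeneity this type is then disjoint from `R`.
    outer-type : ∀ {R} → Cut R → Σ _ λ t → Disjoint t R × UnboundedBelow t
    outer-type {R} cut =
      case pigeonhole lin a₀ Q (λ { t b<c (x , h , x<b , ¬r) → x , h , <-trans x<b b<c , ¬r }) far of λ
        (t , unb) → t , (λ {x} {y} → disjoint unb {x} {y}) , unbounded unb
      where
        Q : Fin (2 ^ suc k) → C → Set
        Q t b = Σ C λ x → HasType t x a₀ × x < b × ¬ R x a₀
        meet : ∀ b → Σ C λ m → m < b × m < a₀
        meet b with compare b a₀
        ... | inj₁ b<a₀        = map₂ (λ m<b → m<b , <-trans m<b b<a₀) (lower cut b)
        ... | inj₂ (inj₁ refl) = map₂ (λ m<b → m<b , m<b) (lower cut b)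
        ... | inj₂ (inj₂ a₀<b) = map₂ (λ m<a₀ → <-trans m<a₀ a₀<b , m<a₀) (lower cut a₀)
        far : ∀ b → Σ _ λ t → Q t b
        far b with meet b
        ... | m , m<b , m<a₀ with ∃-transport (Inv-flip (Inv-¬ (inv cut))) (proj₂ (proper cut a₀)) m
        ...   | x , ¬r with ∉⇒> cut (self cut x) ¬r
        ...     | x<m = map₂ (λ h → x , h , <-trans x<m m<b , λ r → ¬r (down cut m<a₀ r)) (typeOf (<⇒≢ (<-trans x<m m<a₀)))
        disjoint : ∀ {t} → (∀ b → Q t b) → Disjoint t R
        disjoint unb h′ r = let _ , h , _ , ¬r = unb a₀ in ¬r (HasType-determines (inv cut) _ h′ h r)
        unbounded : ∀ {t} → (∀ b → Q t b) → UnboundedBelow t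
        unbounded {t} unb y b with extend₁ a₀ y
        ... | σ , refl with unb (σ ⁻¹ · b)
        ...   | x , h , x<b , _ = σ · x , HasType-inv t σ _ _ h ,
                subst (σ · x <_) (act-inverse {M = M} σ b) (<-inv σ _ _ x<b)

    -- If a type outside R is unbounded below but bounded above, its supremum is a larger cut.
    larger-cut : ∀ {R t} → Cut R → Disjoint t R → UnboundedBelow t → ¬ UnboundedAbove t →
      Cut (cutOf t) × typesOf R ⊂ typesOf (cutOf t)
    larger-cut {R} {t} cut disj unb⁻ ¬unb⁺ with ¬∀⇒∃¬ ¬unb⁺
    ... | y , ¬above with ¬∀⇒∃¬ ¬above | ∃-transport (HasType-inv t) (proj₁ (proj₂ (unb⁻ y y))) y
    ...   | b , ¬∃ | z , h with upper cut b
    ...     | b⁺ , b<b⁺ =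
      cutOf-isCut t h y<z (λ (z , h , b⁺≼z) → ¬∃ (z , h , <-≼-trans b<b⁺ b⁺≼z)) ,
      typesOf-⊂ (inv cut) R⊆cutOf (<⇒≢ y<z) (z , h , inj₂ refl) (disj h)
      where
        y<z : y < z
        y<z = ∉⇒> cut (self cut y) (disj h)
        R⊆cutOf : ∀ u v → R u v → cutOf t u v
        R⊆cutOf u v r = map₂ (λ h′ → h′ , inj₁ (∉⇒> cut r (disj h′))) (∃-transport (HasType-inv t) h u)

    -- An outer type is either unbounded above, which `descent` excludes, or its supremum is a
    -- larger cut. Enlarging stops because there are finitely many types.
    no-cut-above : ∀ R → Cut R → Acc _⊃_ (typesOf R) → ⊥
    no-cut-above R cut (acc rec) =
      case outer-type cut of λ (t , disj , unb⁻) → case lem (UnboundedAbove t) of λ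
        { (yes unb⁺) → descent unb⁺ unb⁻ R cut disj (⊂-wellFounded _)
        ; (no ¬unb⁺) → case larger-cut cut disj unb⁻ ¬unb⁺ of λ (cut′ , grows) → no-cut-above (cutOf t) cut′ (rec grows) }

    no-cut : ∀ {R} → ¬ Cut R
    no-cut cut = no-cut-above _ cut (⊃-wellFounded _)

    -- Cofinality and coinitiality of invariant cones.

    module Cone {_≺_ : Rel₂ C} (≺-inv : Inv _≺_) (≺⇒< : ∀ {x y} → x ≺ y → x < y)
                {x₀ y₀ : C} (x₀≺y₀ : x₀ ≺ y₀) where

      successor : ∀ a → Σ C λ x → a ≺ x
      successor = ∃-transport ≺-inv x₀≺y₀

      -- Otherwise the down-closure of the cone over a point is a proper cut.
      cofinal : ∀ a b → Σ C λ x → a ≺ x × b < x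
      cofinal a b with lem (Σ C λ x → a ≺ x × b < x)
      ... | yes found = found
      ... | no ¬found = ⊥-elim (no-cut cut)
        where
          R : Rel₂ C
          R a x = Σ C λ z → a ≺ z × x ≼ z
          R-inv : Inv R
          R-inv σ a x (z , a≺z , x≼z) = σ · z , ≺-inv σ a z a≺z , map⊎ (<-inv σ x z) (cong (σ ·_)) x≼z
          b⁺ = successor b
          ¬R : ¬ R a (proj₁ b⁺)
          ¬R (z , a≺z , b⁺≼z) = ¬found (z , a≺z , <-≼-trans (≺⇒< (proj₂ b⁺)) b⁺≼z)
          cut : Cut R
          cut .inv = R-inv
          cut .down y<x (z , a≺z , x≼z) = z , a≺z , inj₁ (<-≼-trans y<x x≼z)
          cut .above a = let z , a≺z = successor a in z , ≺⇒< a≺z , z , a≺z , inj₂ refl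
          cut .proper = ∃-transport (Inv-¬ R-inv) ¬R

      -- Otherwise the points with no element of the cone strictly below them form a proper cut.
      coinitial : ∀ {a b} → a < b → Σ C λ x → a ≺ x × x < b
      coinitial {a} {b} a<b with lem (Σ C λ x → a ≺ x × x < b)
      ... | yes found = found
      ... | no ¬found = ⊥-elim (no-cut cut)
        where
          S : Rel₂ C
          S a x = Σ C λ z → a ≺ z × z < x
          S-inv : Inv S
          S-inv σ a x (z , a≺z , z<x) = σ · z , ≺-inv σ a z a≺z , <-inv σ z x z<x
          cut : Cut λ a x → ¬ S a x
          cut .inv = Inv-¬ S-inv
          cut .down y<x ¬s (z , a≺z , z<y) = ¬s (z , a≺z , <-trans z<y y<x)
          cut .above a′ = ∃-transport (Inv-× <-inv (Inv-¬ S-inv)) (a<b , ¬found) a′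
          cut .proper a′ = let z , a≺z = successor a′ ; z′ , z≺z′ = successor z in
            z′ , λ ¬s → ¬s (z , a≺z , ≺⇒< z≺z′)

  -- Intervals containing points high in the other orders.

  module Independence (M : PermStr (suc k)) (ext : Extendible M) (prim : InvariantlyPrimitive M)
    (x₀ y₀ : Carrier M) (x₀≪y₀ : ∀ i → lt M i x₀ y₀)
    (indep : ∀ {i j} → i ≢ j → Σ (Carrier M) λ x → Σ (Carrier M) λ y → lt M i x y × lt M j y x) where
    open Types M ext

    infix 4 _≪_
    _≪_ : Rel₂ C
    x ≪ y = ∀ i → lt M i x y

    ≪-inv : Inv _≪_
    ≪-inv σ x y x≪y i = Inv-lt i σ x y (x≪y i)

    ≪-trans : ∀ {x y z} → x ≪ y → y ≪ z → x ≪ z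
    ≪-trans x≪y y≪z i = Lt.<-trans i (x≪y i) (y≪z i)

    ≪-agree : ∀ {x y x′ y′} → x ≪ y → x′ ≪ y′ → Agree x y x′ y′
    ≪-agree u v i = inj₁ (u i , v i)

    module Up (i : Fin (suc k)) =
      Cuts.Cone M ext prim (linear M i) (Inv-lt i) x₀ ≪-inv (λ x≪y → x≪y i) x₀≪y₀
    module Down (i : Fin (suc k)) =
      Cuts.Cone M ext prim (flip-linear (linear M i)) (Inv-flip (Inv-lt i)) x₀
        (Inv-flip ≪-inv) (λ x≪y → x≪y i) x₀≪y₀

    -- The goals are met one at a time by moving along `≺`, which preserves every goal already met.
    achieveAll : ∀ {N} {_≺_ : Rel₂ C} (S : C → Set) (G : Fin N → C → Set) →
      (∀ p {x y} → x ≺ y → G p x → G p y) →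
      (∀ p x → S x → Σ C λ y → x ≺ y × S y × G p y) →
      ∀ x → S x → Σ C λ y → S y × (∀ p → G p y)
    achieveAll {zero}  S G mono step x s = x , s , λ ()
    achieveAll {suc N} S G mono step x s =
      let y , s′ , g = achieveAll S (G ∘ suc) (mono ∘ suc) (step ∘ suc) x s
          z , y≺z , s″ , g₀ = step zero y s′
      in z , s″ , λ { zero → g₀ ; (suc p) → mono (suc p) y≺z (g p) }

    lowerBound₂ : ∀ x y → Σ C λ a → a ≪ x × a ≪ y
    lowerBound₂ x y =
      let a , a≪x = Down.successor zero x in
      achieveAll {_≺_ = flip _≪_} (_≪ x) (λ i a → lt M i a y)
        (λ i a≪b b<y → Lt.<-trans i (a≪b i) b<y)
        (λ i a a≪x → let b , b≪a , b<y = Down.cofinal i a y in b , b≪a , ≪-trans b≪a a≪x , b<y)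
        a a≪x

    -- A pair on which the two orders disagree gives `z′` below `x′` in `i` and above `x′` in `j`,
    -- with room for a `y′` such that `x′ ≪ y′` and `y′` is still below `z′` in `j`. Carrying the
    -- chain `a′ ≪ x′ ≪ y′` to `a ≪ x ≪ y` takes `z′` to the desired point.
    slab₁ : ∀ {i j} → i ≢ j → ∀ {a b} → lt M i a b → ∀ c → Σ C λ x → a ≪ x × lt M i x b × lt M j c x
    slab₁ {i} {j} i≢j {a} {b} a<b c =
      let x , a≪x , x<b = Up.coinitial i a<b
          y , x≪y , c<y = Up.cofinal j x c
          z′ , x′ , z′<x′ , x′<z′ = indep i≢j
          y′ , x′≪y′ , y′<z′ = Up.coinitial j x′<z′
          a′ , a′≪x′ , a′≪z′ = lowerBound₂ x′ z′
          σ , σa , σx , σy = extend₃ (≪-agree a′≪x′ a≪x)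
            (≪-agree (≪-trans a′≪x′ x′≪y′) (≪-trans a≪x x≪y)) (≪-agree x′≪y′ x≪y)
          z<x = subst (lt M i (σ · z′)) σx (Inv-lt i σ _ _ z′<x′)
          y<z = subst (λ v → lt M j v (σ · z′)) σy (Inv-lt j σ _ _ y′<z′)
      in σ · z′ , subst (_≪ σ · z′) σa (≪-inv σ _ _ a′≪z′) , Lt.<-trans i z<x x<b , Lt.<-trans j c<y y<z

    -- `slab₁` is applied for each point of `F` and each order other than `i`. All moves go up in
    -- every order and stay below `b` in `i`, so nothing gained is lost.
    slab : ∀ i {a b} → lt M i a b → ∀ {N} (F : Fin N → C) →
      Σ C λ x → (lt M i a x × lt M i x b) × (∀ p j → j ≢ i → lt M j (F p) x)
    slab i {a} {b} a<b {N} F =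
      let x , a≪x , x<b = Up.coinitial i a<b in
      achieveAll {_≺_ = _≪_} Between (λ p → Beyond (F p))
        (λ p x≪y above j j≢i → Lt.<-trans j (above j j≢i) (x≪y j)) achieve x (a≪x i , x<b)
      where
        Between : C → Set
        Between x = lt M i a x × lt M i x b
        Beyond : C → C → Set
        Beyond c x = ∀ j → j ≢ i → lt M j c x
        achieve : ∀ p x → Between x → Σ C λ y → x ≪ y × Between y × Beyond (F p) y
        achieve p x (a<x , x<b) =
          let x₁ , x≪x₁ , x₁<b = Up.coinitial i x<b
              y , (x≪y , y<b) , beyond = achieveAll {_≺_ = _≪_} (λ y → x ≪ y × lt M i y b) (λ j y → j ≢ i → lt M j (F p) y)
                (λ j y≪z above j≢i → Lt.<-trans j (above j≢i) (y≪z j)) one x₁ (x≪x₁ , x₁<b)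
          in y , x≪y , (Lt.<-trans i a<x (x≪y i) , y<b) , beyond
          where
            one : ∀ j y → x ≪ y × lt M i y b → Σ C λ z → y ≪ z × (x ≪ z × lt M i z b) × (j ≢ i → lt M j (F p) z)
            one j y (x≪y , y<b) with j ≟ i
            ... | yes j≡i = let z , y≪z , z<b = Up.coinitial i y<b in
              z , y≪z , (≪-trans x≪y y≪z , z<b) , λ j≢i → ⊥-elim (j≢i j≡i)
            ... | no j≢i = let z , y≪z , z<b , c<z = slab₁ (≢-sym j≢i) y<b (F p) in
              z , y≪z , (≪-trans x≪y y≪z , z<b) , λ _ → c<z

    bounds : ∀ i {N} (F : Fin N → C) → Σ C λ a → Σ C λ b → lt M i a b × (∀ p → lt M i a (F p) × lt M i (F p) b)
    bounds i {zero}  F = x₀ , y₀ , x₀≪y₀ i , λ ()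
    bounds i {suc N} F =
      let a , b , a<b , within = bounds i (F ∘ suc)
          a′ , a′≪a , a′<F₀ = Down.cofinal i a (F zero)
          b′ , b≪b′ , F₀<b′ = Up.cofinal i b (F zero)
      in a′ , b′ , Lt.<-trans i (a′≪a i) (Lt.<-trans i a<b (b≪b′ i)) , λ
        { zero    → a′<F₀ , F₀<b′
        ; (suc p) → Lt.<-trans i (a′≪a i) (proj₁ (within p)) , Lt.<-trans i (proj₂ (within p)) (b≪b′ i) }

    -- Realising cuts and separating two points over a finite set.

    module _ (i : Fin (suc k)) where
      open Lt i using (_≼_; irrefl; <-trans; <-≼-trans; ≼-<-trans; compare)

      DownClosed : (C → Set) → Set
      DownClosed D = ∀ {x y} → lt M i x y → D y → D x

      -- `a` is raised to points of `F` in `D` and `b` lowered to points of `F` outside `D`, until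
      -- no point of `F` lies strictly between.
      split : ∀ {D a b} → DownClosed D → D a → ¬ D b → ∀ {N} (F : Fin N → C) →
        Σ C λ a′ → Σ C λ b′ → D a′ × (¬ D b′) × (∀ p → (D (F p) → F p ≼ a′) × (¬ D (F p) → b′ ≼ F p))
      split {a = a} {b} down d ¬d {zero} F = a , b , d , ¬d , λ ()
      split {D} down d ¬d {suc N} F with split down d ¬d (F ∘ suc) | lem (D (F zero))
      ... | a , b , d′ , ¬d′ , h | yes D₀ with compare a (F zero)
      ...   | inj₁ a<F₀ = F zero , b , D₀ , ¬d′ , λ
              { zero → (λ _ → inj₂ refl) , λ ¬D₀ → ⊥-elim (¬D₀ D₀)
              ; (suc p) → (λ Dp → inj₁ (≼-<-trans (proj₁ (h p) Dp) a<F₀)) , proj₂ (h p) }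
      ...   | inj₂ F₀≼a = a , b , d′ , ¬d′ , λ
              { zero → (λ _ → [ inj₂ ∘ sym , inj₁ ]′ F₀≼a) , λ ¬D₀ → ⊥-elim (¬D₀ D₀)
              ; (suc p) → h p }
      split {D} down d ¬d {suc N} F | a , b , d′ , ¬d′ , h | no ¬D₀ with compare (F zero) b
      ...   | inj₁ F₀<b = a , F zero , d′ , ¬D₀ , λ
              { zero → (λ D₀ → ⊥-elim (¬D₀ D₀)) , λ _ → inj₂ refl
              ; (suc p) → proj₁ (h p) , λ ¬Dp → inj₁ (<-≼-trans F₀<b (proj₂ (h p) ¬Dp)) }
      ...   | inj₂ b≼F₀ = a , b , d′ , ¬d′ , λ
              { zero → (λ D₀ → ⊥-elim (¬D₀ D₀)) , λ _ → [ inj₂ ∘ sym , inj₁ ]′ b≼F₀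
              ; (suc p) → h p }

      insert⁺ : ∀ {D} → DownClosed D → ∀ {N} (F : Fin N → C) →
        Σ C λ x → ∀ p → (D (F p) → lt M i (F p) x) × (¬ D (F p) → lt M i x (F p)) × (∀ j → j ≢ i → lt M j (F p) x)
      insert⁺ {D} down F =
        let a₀ , b₀ , a₀<b₀ , within = bounds i F
            -- `D` may be empty or everything, so it is altered to contain `a₀` and omit `b₀`;
            -- membership of the points of `F` stays the same.
            D′ : C → Set
            D′ y = (D y ⊎ y ≼ a₀) × lt M i y b₀
            down′ : DownClosed D′
            down′ x<y (d , y<b₀) = map⊎ (down x<y) (λ y≼a₀ → inj₁ (<-≼-trans x<y y≼a₀)) d , <-trans x<y y<b₀
            a , b , (da , a<b₀) , ¬db , h = split down′ (inj₂ (inj₂ refl) , a₀<b₀) (λ (_ , b₀<b₀) → irrefl b₀<b₀) F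
            x , (a<x , x<b) , beyond = slab i (a<b down′ (da , a<b₀) ¬db) F
        in x , λ p →
          (λ d → ≼-<-trans (proj₁ (h p) (inj₁ d , proj₂ (within p))) a<x) ,
          (λ ¬d → <-≼-trans x<b (proj₂ (h p) λ { (inj₁ d , _) → ¬d d
                                               ; (inj₂ Fp≼a₀ , _) → irrefl (≼-<-trans Fp≼a₀ (proj₁ (within p))) })) ,
          beyond p
        where
          a<b : ∀ {D a b} → DownClosed D → D a → ¬ D b → lt M i a b
          a<b {a = a} {b} down d ¬d with compare a b
          ... | inj₁ a<b         = a<b
          ... | inj₂ (inj₁ refl) = ⊥-elim (¬d d)
          ... | inj₂ (inj₂ b<a)  = ⊥-elim (¬d (down b<a d))

    -- A point that realises a prescribed cut in the order i and lies above everything in the other orders.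
    insert : ∀ i s {D : C → Set} → (∀ {x y} → sgn s (lt M i) x y → D y → D x) → ∀ {N} (F : Fin N → C) →
      Σ C λ x → ∀ p → (D (F p) → sgn s (lt M i) (F p) x) × (¬ D (F p) → sgn s (lt M i) x (F p)) ×
                      (∀ j → j ≢ i → lt M j (F p) x)
    insert i zero       down F = insert⁺ i down F
    insert i (suc zero) down F =
      let x , h = insert⁺ i (λ x<y ¬dy dx → ¬dy (down x<y dx)) F in
      x , λ p → (λ d → proj₁ (proj₂ (h p)) λ ¬d → ¬d d) , (λ ¬d → proj₁ (h p) ¬d) , proj₂ (proj₂ (h p))

    -- In the signed order `i`, `e` fills the cut of `V` over `B` from below `V`, while `e′` fills
    -- the same cut over `B` from above `U`. Both are above all of `B` in the other orders, so an
    -- automorphism fixes `B` and takes `e′` to `e`; it brings `U` below `e`.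
    separate₁ : ∀ i s {N} (B : Fin N → C) {U V} →
      (∀ p → B p ≢ V) → (∀ p → sgn s (lt M i) V (B p) → sgn s (lt M i) U (B p)) → (∀ p q → p ≢ q → B p ≢ B q) →
      Σ Aut λ σ → Σ C λ e → (∀ p → σ · B p ≡ B p) × (∀ p → e ≢ B p) ×
        sgn s (lt M i) (σ · U) e × sgn s (lt M i) e V ×
        (∀ j → j ≢ i → lt M j (σ · U) e × lt M j V e)
    separate₁ i s {N} B {U} {V} B≢V compat B-distinct =
      σ , e , σ-fixes ∘ suc , e≢B ,
      subst (σ · U ≺_) (σ-fixes zero) (≺-inv σ _ _ (proj₁ (hg zero) (inj₂ (inj₂ refl)))) ,
      proj₁ (proj₂ (hf zero)) irrefl ,
      λ j j≢i → subst (lt M j (σ · U)) (σ-fixes zero) (Inv-lt j σ _ _ (proj₂ (proj₂ (hg zero)) j j≢i)) ,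
                proj₂ (proj₂ (hf zero)) j j≢i
      where
        _≺_ : Rel₂ C
        _≺_ = sgn s (lt M i)
        open StrictLinear (sgn-linear s (linear M i))
        ≺-inv : Inv _≺_
        ≺-inv = sgn-inv i s
        -- Including `U` puts `e′` above `U`; by `compat` this adds no point of `B` to those below
        -- `V`.
        Dg : C → Set
        Dg y = (Σ (Fin N) λ p → B p ≺ V × y ≼ B p) ⊎ y ≼ U
        Dg-down : ∀ {x y} → x ≺ y → Dg y → Dg x
        Dg-down x≺y = map⊎ (λ (p , v , y≼) → p , v , inj₁ (<-≼-trans x≺y y≼)) (λ y≼U → inj₁ (<-≼-trans x≺y y≼U))
        ef = insert i s {D = _≺ V} <-trans (extend V B)
        eg = insert i s {D = Dg} Dg-down (extend U B)
        e  = proj₁ ef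
        hf = proj₂ ef
        e′ = proj₁ eg
        hg = proj₂ eg
        e≢B : ∀ p → e ≢ B p
        e≢B p e≡Bp with lem (B p ≺ V)
        ... | yes Bp≺V = <⇒≢ (proj₁ (hf (suc p)) Bp≺V) (sym e≡Bp)
        ... | no Bp⊀V  = <⇒≢ (proj₁ (proj₂ (hf (suc p))) Bp⊀V) e≡Bp
        Dg⇒≺V : ∀ p → Dg (B p) → B p ≺ V
        Dg⇒≺V p (inj₁ (q , Bq≺V , Bp≼Bq)) = ≼-<-trans Bp≼Bq Bq≺V
        Dg⇒≺V p (inj₂ Bp≼U) with ≢⇒<> (B≢V p)
        ... | inj₁ Bp≺V = Bp≺V
        ... | inj₂ V≺Bp = ⊥-elim (irrefl (≼-<-trans Bp≼U (compat p V≺Bp)))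
        unsigned : ∀ s {x y x′ y′} →
          (sgn s (lt M i) x y × sgn s (lt M i) x′ y′) ⊎ (sgn s (lt M i) y x × sgn s (lt M i) y′ x′) →
          (lt M i x y × lt M i x′ y′) ⊎ (lt M i y x × lt M i y′ x′)
        unsigned zero       = id
        unsigned (suc zero) = swap
        agree : ∀ p → Agree e′ (B p) e (B p)
        agree p j with j ≟ i
        ... | no j≢i = inj₂ (proj₂ (proj₂ (hg (suc p))) j j≢i , proj₂ (proj₂ (hf (suc p))) j j≢i)
        ... | yes refl with lem (B p ≺ V)
        ...   | yes Bp≺V = unsigned s (inj₂ (proj₁ (hg (suc p)) (inj₁ (p , Bp≺V , inj₂ refl)) , proj₁ (hf (suc p)) Bp≺V))
        ...   | no Bp⊀V  = unsigned s (inj₁ (proj₁ (proj₂ (hg (suc p))) (Bp⊀V ∘ Dg⇒≺V p) , proj₁ (proj₂ (hf (suc p))) Bp⊀V))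
        self-agree : Iso B B
        self-agree p q p≢q j = map⊎ (λ u → u , u) (λ u → u , u) (Lt.≢⇒<> j (B-distinct p q p≢q))
        σ₊ = extendIso (Iso-cons agree self-agree)
        σ = proj₁ σ₊
        σ-fixes = proj₂ σ₊

    module _ (s : Fin (suc k) → Fin 2) where
      _≺⟨_⟩_ : C → Fin (suc k) → C → Set
      x ≺⟨ i ⟩ y = sgn (s i) (lt M i) x y

      -- The points e added to the base B are between U and V in one order each, and above
      -- both in the other orders, so they do not obstruct the separations that are still to be made.
      separate : ∀ {m} (is : Fin m → Fin (suc k)) {N} (B : Fin N → C) {U V} →
        (∀ p q → p ≢ q → B p ≢ B q) → (∀ p → B p ≢ V) →
        (∀ i p → V ≺⟨ i ⟩ B p → U ≺⟨ i ⟩ B p) →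
        Σ Aut λ σ → (∀ p → σ · B p ≡ B p) × (∀ r → (σ · U) ≺⟨ is r ⟩ V)
      separate {zero}  is B B-distinct B≢V compat = (↔-refl , λ i x y → mk⇔ id id) , (λ _ → refl) , λ ()
      separate {suc m} is {N} B {U} {V} B-distinct B≢V compat =
        let i = is zero
            σ , e , σB , e≢B , U≺e , e≺V , beyond = separate₁ i (s i) B B≢V (compat i) B-distinct
            τ , τB , separated = separate (is ∘ suc) (extend e B) {U = σ · U} {V = V}
              (λ { zero    zero    p≢q → ⊥-elim (p≢q refl)
                 ; zero    (suc q) _   → e≢B q
                 ; (suc p) zero    _   → ≢-sym (e≢B p)
                 ; (suc p) (suc q) p≢q → B-distinct p q (p≢q ∘ cong suc) })
              (λ { zero → Sgn.<⇒≢ i e≺V ; (suc p) → B≢V p })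
              (λ { j zero    → above-e i j {U = σ · U} e≺V beyond
                 ; j (suc p) → λ V≺Bp → subst ((σ · U) ≺⟨ j ⟩_) (σB p) (≺-inv j σ (compat j p V≺Bp)) })
        in compose M σ τ , (λ p → trans (cong (τ ·_) (σB p)) (τB (suc p))) , λ
             -- `τ` fixes `e`, so the separation in the order `i` survives the later ones.
             { zero    → Sgn.<-trans i (subst ((τ · σ · U) ≺⟨ i ⟩_) (τB zero) (≺-inv i τ U≺e)) e≺V
             ; (suc r) → separated r }
        where
          module Sgn (i : Fin (suc k)) = StrictLinear (sgn-linear (s i) (linear M i))
          ≺-inv : ∀ i σ {x y} → x ≺⟨ i ⟩ y → (σ · x) ≺⟨ i ⟩ (σ · y)
          ≺-inv i σ = sgn-inv i (s i) σ _ _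
          above-e : ∀ i j {U e V} → e ≺⟨ i ⟩ V → (∀ j → j ≢ i → lt M j U e × lt M j V e) → V ≺⟨ j ⟩ e → U ≺⟨ j ⟩ e
          above-e i j e≺V beyond V≺e with j ≟ i
          ... | yes refl = ⊥-elim (Sgn.irrefl i (Sgn.<-trans i V≺e e≺V))
          ... | no j≢i with s j | beyond j j≢i
          ...   | zero     | u , v = u
          ...   | suc zero | u , v = ⊥-elim (Lt.irrefl j (Lt.<-trans j V≺e v))

    -- Amalgamation and realisation of finite structures.

    preserves⇒Iso : ∀ (A : PermStr (suc k)) (t : Fin n → Carrier A) → Injective _≡_ _≡_ t → (f g : Fin n → C) →
      (∀ i p q → lt A i (t p) (t q) → lt M i (f p) (f q)) →
      (∀ i p q → lt A i (t p) (t q) → lt M i (g p) (g q)) → Iso f g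
    preserves⇒Iso A t t-inj f g f-pres g-pres p q p≢q i =
      map⊎ (λ u → f-pres i p q u , g-pres i p q u) (λ u → f-pres i q p u , g-pres i q p u)
        (StrictLinear.≢⇒<> (linear A i) (p≢q ∘ t-inj))

    skip : Fin (suc n) → Fin (suc (suc n))
    skip zero    = zero
    skip (suc p) = suc (suc p)

    skip-injective : Injective _≡_ _≡_ (skip {n})
    skip-injective {x = zero}  {y = zero}  _    = refl
    skip-injective {x = suc p} {y = suc .p} refl = refl

    -- The copies of A ∖ {u} and A ∖ {v} are first made to agree on the remaining points; then the image
    -- of u is moved so that it compares with the image of v as in A.
    module Amalgamation (A : PermStr (suc k)) {n} (t : Fin (suc (suc n)) → Carrier A) (t-inj : Injective _≡_ _≡_ t)
      (f g : Fin (suc n) → C)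
      (f-pres : ∀ i p q → lt A i (t (suc p)) (t (suc q)) → lt M i (f p) (f q))
      (g-pres : ∀ i p q → lt A i (t (skip p)) (t (skip q)) → lt M i (g p) (g q)) where

      B = f ∘ suc
      V = f zero
      σ₊ = extendIso (preserves⇒Iso A (λ p → t (suc (suc p))) (suc-injective ∘ suc-injective ∘ t-inj) (g ∘ suc) B
             (λ i p q → g-pres i (suc p) (suc q)) (λ i p q → f-pres i (suc p) (suc q)))
      σ = proj₁ σ₊
      U = σ · g zero
      U<B : ∀ i p → lt A i (t zero) (t (suc (suc p))) → lt M i U (B p)
      U<B i p u<p = subst (lt M i U) (proj₂ σ₊ p) (Inv-lt i σ _ _ (g-pres i zero (suc p) u<p))
      B<U : ∀ i p → lt A i (t (suc (suc p))) (t zero) → lt M i (B p) U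
      B<U i p p<u = subst (λ b → lt M i b U) (proj₂ σ₊ p) (Inv-lt i σ _ _ (g-pres i (suc p) zero p<u))
      self-Iso : Iso f f
      self-Iso = preserves⇒Iso A (t ∘ suc) (suc-injective ∘ t-inj) f f (f-pres) (f-pres)
      f-distinct : ∀ p q → p ≢ q → f p ≢ f q
      f-distinct p q p≢q = p≢q ∘ Iso⇒injective self-Iso
      reflects : ∀ i p q → lt M i (f p) (f q) → lt A i (t (suc p)) (t (suc q))
      reflects i p q fp<fq with StrictLinear.compare (linear A i) (t (suc p)) (t (suc q))
      ... | inj₁ p<q        = p<q
      ... | inj₂ (inj₂ q<p) = ⊥-elim (Lt.irrefl i (Lt.<-trans i fp<fq (f-pres i q p q<p)))
      ... | inj₂ (inj₁ p≡q) with suc-injective (t-inj p≡q)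
      ...   | refl = ⊥-elim (Lt.irrefl i fp<fq)
      side : ∀ i → Σ (Fin 2) λ s → sgn s (lt A i) (t zero) (t (suc zero))
      side i = [ (λ u<v → zero , u<v) , (λ v<u → suc zero , v<u) ]′
        (StrictLinear.≢⇒<> (linear A i) (λ u≡v → case t-inj u≡v of λ ()))
      s : Fin (suc k) → Fin 2
      s = proj₁ ∘ side
      -- Transitivity in `A` through the second point fixes the side of the first, and `g` followed
      -- by `σ` transfers this to `U`.
      sgn-compat : ∀ i s p → sgn s (lt A i) (t zero) (t (suc zero)) → sgn s (lt M i) V (B p) → sgn s (lt M i) U (B p)
      sgn-compat i zero       p u<v h = U<B i p (StrictLinear.<-trans (linear A i) u<v (reflects i zero (suc p) h))
      sgn-compat i (suc zero) p v<u h = B<U i p (StrictLinear.<-trans (linear A i) (reflects i (suc p) zero h) v<u)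
      sgn-reflects : ∀ i s {u v x y} → sgn s (lt A i) u v → sgn s (lt M i) x y →
        (lt A i u v → lt M i x y) × (lt A i v u → lt M i y x)
      sgn-reflects i zero       u<v x<y = (λ _ → x<y) , λ v<u →
        ⊥-elim (StrictLinear.irrefl (linear A i) (StrictLinear.<-trans (linear A i) u<v v<u))
      sgn-reflects i (suc zero) v<u y<x = (λ u<v →
        ⊥-elim (StrictLinear.irrefl (linear A i) (StrictLinear.<-trans (linear A i) u<v v<u))) , λ _ → y<x
      compat : ∀ i p → sgn (s i) (lt M i) V (B p) → sgn (s i) (lt M i) U (B p)
      compat i p = sgn-compat i (s i) p (proj₂ (side i))
      separation = separate s id B {U = U} {V = V} (λ p q p≢q → f-distinct (suc p) (suc q) (p≢q ∘ suc-injective))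
        (λ p → f-distinct (suc p) zero λ ()) compat
      τ = proj₁ separation
      τB = proj₁ (proj₂ separation)
      separated = proj₂ (proj₂ separation)
      -- `extend V B` equals `f` only pointwise, so cases are needed for the types to compute.
      pres : ∀ i p q → lt A i (t (suc p)) (t (suc q)) → lt M i (extend V B p) (extend V B q)
      pres i zero    zero    = f-pres i zero zero
      pres i zero    (suc q) = f-pres i zero (suc q)
      pres i (suc p) zero    = f-pres i (suc p) zero
      pres i (suc p) (suc q) = f-pres i (suc p) (suc q)
      amalgam : Fin (suc (suc n)) → C
      amalgam = extend (τ · U) (extend V B)
      amalgam-pres : ∀ i p q → lt A i (t p) (t q) → lt M i (amalgam p) (amalgam q)
      amalgam-pres i zero          zero          u<u = ⊥-elim (StrictLinear.irrefl (linear A i) u<u)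
      amalgam-pres i zero          (suc zero)    u<v = proj₁ (sgn-reflects i (s i) (proj₂ (side i)) (separated i)) u<v
      amalgam-pres i (suc zero)    zero          v<u = proj₂ (sgn-reflects i (s i) (proj₂ (side i)) (separated i)) v<u
      amalgam-pres i zero          (suc (suc p)) u<p = subst (lt M i (τ · U)) (τB p) (Inv-lt i τ _ _ (U<B i p u<p))
      amalgam-pres i (suc (suc p)) zero          p<u = subst (λ b → lt M i b (τ · U)) (τB p) (Inv-lt i τ _ _ (B<U i p p<u))
      amalgam-pres i (suc p)       (suc q)       p<q = pres i p q p<q

    -- Induction on the number of points: copies omitting the first and the second point are
    -- amalgamated.
    realise : ∀ (A : PermStr (suc k)) n (t : Fin n → Carrier A) → Injective _≡_ _≡_ t →
      Σ (Fin n → C) λ f → ∀ i p q → lt A i (t p) (t q) → lt M i (f p) (f q)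
    realise A zero t t-inj = (λ ()) , λ _ ()
    realise A (suc zero) t t-inj = (λ _ → x₀) , λ { i zero zero u → ⊥-elim (StrictLinear.irrefl (linear A i) u) }
    realise A (suc (suc n)) t t-inj =
      let f , f-pres = realise A (suc n) (t ∘ suc) (suc-injective ∘ t-inj)
          g , g-pres = realise A (suc n) (t ∘ skip) (skip-injective ∘ t-inj)
          open Amalgamation A t t-inj f g f-pres g-pres
      in amalgam , amalgam-pres

-- From definable to invariant equivalence relations.

bigAnd bigOr : ∀ {m} → (Fin m → Formula k n) → Formula k n
bigAnd {m = zero}  φ = falsum ⇒ falsum
bigAnd {m = suc m} φ = φ zero ∧ bigAnd (φ ∘ suc)
bigOr {m = zero}  φ = falsum
bigOr {m = suc m} φ = φ zero ∨ bigOr (φ ∘ suc)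

module _ (M : PermStr k) {env : Fin n → Carrier M} where
  Sat-bigAnd⁺ : ∀ {m} (φ : Fin m → Formula k n) → (∀ r → Sat M env (φ r)) → Sat M env (bigAnd φ)
  Sat-bigAnd⁺ {zero}  φ h = id
  Sat-bigAnd⁺ {suc m} φ h = h zero , Sat-bigAnd⁺ (φ ∘ suc) (h ∘ suc)

  Sat-bigAnd⁻ : ∀ {m} (φ : Fin m → Formula k n) → Sat M env (bigAnd φ) → ∀ r → Sat M env (φ r)
  Sat-bigAnd⁻ φ (h , _) zero    = h
  Sat-bigAnd⁻ φ (_ , h) (suc r) = Sat-bigAnd⁻ (φ ∘ suc) h r

  Sat-bigOr⁺ : ∀ {m} (φ : Fin m → Formula k n) r → Sat M env (φ r) → Sat M env (bigOr φ)
  Sat-bigOr⁺ φ zero    h = inj₁ h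
  Sat-bigOr⁺ φ (suc r) h = inj₂ (Sat-bigOr⁺ (φ ∘ suc) r h)

  Sat-bigOr⁻ : ∀ {m} (φ : Fin m → Formula k n) → Sat M env (bigOr φ) → Σ (Fin m) λ r → Sat M env (φ r)
  Sat-bigOr⁻ {suc m} φ (inj₁ h) = zero , h
  Sat-bigOr⁻ {suc m} φ (inj₂ h) = let r , h′ = Sat-bigOr⁻ (φ ∘ suc) h in suc r , h′

sgnRel : Fin 2 → Fin k → Formula k 2
sgnRel zero       i = rel i zero (suc zero)
sgnRel (suc zero) i = rel i (suc zero) zero

Sat-sgnRel : (M : PermStr k) → ∀ s i {x y} → Sat M (pair x y) (sgnRel s i) ⇔ sgn s (lt M i) x y
Sat-sgnRel M zero       i = mk⇔ id id
Sat-sgnRel M (suc zero) i = mk⇔ id id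

module _ (lem : ∀ (P : Set) → Dec P) (M : PermStr (suc k)) (ext : Extendible M) where
  open Classical lem using (module Types)
  open Types M ext

  -- An invariant equivalence consists of equality and the types it meets. These are finitely many
  -- conjunctions of signed atoms, so a quantifier-free formula defines it.
  invariantlyPrimitive : Primitive M → InvariantlyPrimitive M
  invariantlyPrimitive prim E E-equiv E-inv = map⊎
    (λ h x y e → to (h x y) (E⇒φ e)) (λ h x y → φ⇒E (h x y)) (prim φ φ-equiv)
    where
      open IsEquivalence E-equiv renaming (refl to E-refl; sym to E-sym; trans to E-trans)
      Realised : Fin (2 ^ suc k) → Set
      Realised t = Σ C λ x → Σ C λ y → HasType t x y × E x y
      typeFormula : Fin (2 ^ suc k) → Formula (suc k) 2
      typeFormula t = bigAnd λ i → sgnRel (finToFun t i) i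
      disjunct : ∀ t → Dec (Realised t) → Formula (suc k) 2
      disjunct t (yes _) = typeFormula t
      disjunct t (no _)  = falsum
      φ : Formula (suc k) 2
      φ = equ zero (suc zero) ∨ bigOr λ t → disjunct t (lem (Realised t))
      φ⇒E : ∀ {x y} → Defined M φ x y → E x y
      φ⇒E (inj₁ refl) = E-refl
      φ⇒E {x} {y} (inj₂ h) with Sat-bigOr⁻ M (λ t → disjunct t (lem (Realised t))) h
      ... | t , h′ with lem (Realised t)
      ...   | yes (_ , _ , h″ , e) = HasType-determines E-inv t h″
              (λ i → to (Sat-sgnRel M (finToFun t i) i) (Sat-bigAnd⁻ M (λ i → sgnRel (finToFun t i) i) h′ i)) e
      E⇒φ : ∀ {x y} → E x y → Defined M φ x y
      E⇒φ {x} {y} e with lem (x ≡ y)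
      ... | yes x≡y = inj₁ x≡y
      ... | no x≢y  = let t , h = typeOf x≢y in
            inj₂ (Sat-bigOr⁺ M (λ t → disjunct t (lem (Realised t))) t (holds t h (lem (Realised t))))
        where
          holds : ∀ t → HasType t x y → (d : Dec (Realised t)) → Sat M (pair x y) (disjunct t d)
          holds t h (yes _)   = Sat-bigAnd⁺ M (λ i → sgnRel (finToFun t i) i) λ i → from (Sat-sgnRel M (finToFun t i) i) (h i)
          holds t h (no ¬real) = ⊥-elim (¬real (x , y , h , e))
      φ-equiv : IsEquivalence (Defined M φ)
      φ-equiv = record
        { refl  = inj₁ refl
        ; sym   = λ u → E⇒φ (E-sym (φ⇒E u))
        ; trans = λ u v → E⇒φ (E-trans (φ⇒E u) (φ⇒E v)) }

-- Orders equal up to reversal, reorientation and reducts.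

Related : Rel₂ A → Rel₂ A → Set
Related R S = SameRel R S ⊎ OppositeRel R S

Related-sym : {R S : Rel₂ A} → Related R S → Related S R
Related-sym (inj₁ h) = inj₁ λ x y → mk⇔ (from (h x y)) (to (h x y))
Related-sym (inj₂ h) = inj₂ λ x y → mk⇔ (from (h y x)) (to (h y x))

Related-unsgn : ∀ s s′ {R S : Rel₂ A} → SameRel (sgn s R) (sgn s′ S) → Related R S
Related-unsgn zero       zero       h = inj₁ h
Related-unsgn zero       (suc zero) h = inj₂ h
Related-unsgn (suc zero) zero       h = inj₂ λ x y → h y x
Related-unsgn (suc zero) (suc zero) h = inj₁ λ x y → h y x

reorient : ∀ {m} → (Fin m → Fin 2) → PermStr m → PermStr m
reorient s M = record
  { Carrier = Carrier M
  ; lt      = λ p → sgn (s p) (lt M p)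
  ; linear  = λ p → sgn-linear (s p) (linear M p) }

module _ (M : PermStr k) {m} (e : Fin m → Fin k) (s : Fin m → Fin 2) where
  private M′ = reorient s (reduct M e)

  automorphism-reduct : Automorphism M → Automorphism M′
  automorphism-reduct (σ , pres) = σ , λ p x y → sgn-pres (s p) (pres (e p))
    where
      sgn-pres : ∀ s {R : Rel₂ (Carrier M)} → (∀ x y → R x y ⇔ R (Inverse.to σ x) (Inverse.to σ y)) →
        ∀ {x y} → sgn s R x y ⇔ sgn s R (Inverse.to σ x) (Inverse.to σ y)
      sgn-pres zero       h = h _ _
      sgn-pres (suc zero) h = h _ _

  invariantlyPrimitive-reduct : InvariantlyPrimitive M → InvariantlyPrimitive M′
  invariantlyPrimitive-reduct prim E E-equiv E-inv = prim E E-equiv (E-inv ∘ automorphism-reduct)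

  -- An isomorphism between finite parts of `M′` respects every order of `M`, each being a kept one
  -- up to reversal, so it extends in `M`.
  extendible-reduct : (∀ j → Σ (Fin m) λ p → Related (lt M j) (lt M (e p))) → Extendible M → Extendible M′
  extendible-reduct determined ext n a b a-inj b-inj iso =
    let σ , h = ext n a b a-inj b-inj λ j p q → let r , related = determined j in transfer related (unsgn (s r) (iso r)) p q
    in automorphism-reduct σ , h
    where
      Agreeing : Rel₂ (Carrier M) → Set
      Agreeing R = ∀ p q → R (a p) (a q) ⇔ R (b p) (b q)
      unsgn : ∀ s {R} → Agreeing (sgn s R) → Agreeing R
      unsgn zero       h = h
      unsgn (suc zero) h p q = h q p
      transfer : ∀ {R S} → Related R S → Agreeing S → Agreeing R
      transfer (inj₁ same) h p q = mk⇔ (from (same _ _) ∘ to (h p q) ∘ to (same _ _)) (from (same _ _) ∘ from (h p q) ∘ to (same _ _))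
      transfer (inj₂ opp)  h p q = mk⇔ (from (opp _ _) ∘ to (h q p) ∘ to (opp _ _)) (from (opp _ _) ∘ from (h q p) ∘ to (opp _ _))

reorient-reflects : ∀ {m} (s : Fin m → Fin 2) (A B : PermStr m) (f : Carrier A → Carrier B) →
  (∀ p x y → lt (reorient s A) p x y → lt (reorient s B) p (f x) (f y)) →
  ∀ p x y → lt A p x y → lt B p (f x) (f y)
reorient-reflects s A B f pres p x y with s p | pres p
... | zero     | h = h x y
... | suc zero | h = h y x

-- Linearity turns preservation into reflection; injectivity takes one order, hence `suc m`.
preserves⇒embedding : ∀ {m} (A B : PermStr (suc m)) (f : Carrier A → Carrier B) →
  (∀ p x y → lt A p x y → lt B p (f x) (f y)) → Embedding A B
preserves⇒embedding A B f pres = f , injective , λ p x y → mk⇔ (pres p x y) (reflects p x y)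
  where
    injective : Injective _≡_ _≡_ f
    injective {x} {y} fx≡fy with proj₂ (proj₂ (linear A zero)) x y
    ... | inj₁ x<y        = ⊥-elim (StrictLinear.<⇒≢ (linear B zero) (pres zero x y x<y) fx≡fy)
    ... | inj₂ (inj₁ x≡y) = x≡y
    ... | inj₂ (inj₂ y<x) = ⊥-elim (StrictLinear.<⇒≢ (linear B zero) (pres zero y x y<x) (sym fx≡fy))
    reflects : ∀ p x y → lt B p (f x) (f y) → lt A p x y
    reflects p x y fx<fy with proj₂ (proj₂ (linear A p)) x y
    ... | inj₁ x<y         = x<y
    ... | inj₂ (inj₁ refl) = ⊥-elim (StrictLinear.irrefl (linear B p) fx<fy)
    ... | inj₂ (inj₂ y<x)  = ⊥-elim (StrictLinear.irrefl (linear B p)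
            (StrictLinear.<-trans (linear B p) fx<fy (pres p y x y<x)))

-- Choice of the orders and genericity of the reduct.

module _ (lem : ∀ (P : Set) → Dec P) where
  open Classical lem

  -- Greedy choice: an order is added only if it is related to none of those already kept.
  representatives : (L : Fin k → Rel₂ A) → Σ ℕ λ m → Σ (Fin m → Fin k) λ e → Injective _≡_ _≡_ e ×
    (∀ j → Σ (Fin m) λ p → Related (L j) (L (e p))) × (∀ p q → p ≢ q → ¬ Related (L (e p)) (L (e q)))
  representatives {k = zero} L = 0 , (λ ()) , (λ { {()} }) , (λ ()) , λ ()
  representatives {k = suc k} L with representatives (L ∘ suc)
  ... | m , e , e-inj , covers , distinct with lem (Σ (Fin m) λ p → Related (L zero) (L (suc (e p))))
  ...   | yes covered = m , suc ∘ e , e-inj ∘ suc-injective , (λ { zero → covered ; (suc j) → covers j }) , distinct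
  ...   | no ¬covered = suc m , extend zero (suc ∘ e) , inj ,
            (λ { zero → zero , inj₁ (λ x y → mk⇔ id id) ; (suc j) → let p , r = covers j in suc p , r }) ,
            λ { zero    zero    p≢q r → p≢q refl
              ; zero    (suc q) _   r → ¬covered (q , r)
              ; (suc p) zero    _   r → ¬covered (p , Related-sym r)
              ; (suc p) (suc q) p≢q r → distinct p q (p≢q ∘ cong suc) r }
    where
      inj : Injective _≡_ _≡_ (extend zero (suc ∘ e))
      inj {zero}  {zero}  _  = refl
      inj {suc p} {suc q} eq = cong suc (e-inj (suc-injective eq))

  -- Orders are reversed so that `x₀` is below `y₀` in all of them, as the amalgamation argument
  -- requires. The finite structure is reversed by the same signs, which cancel at the end.
  generic : (M : PermStr (suc k)) → CountablyInfinite M → Extendible M → InvariantlyPrimitive M →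
    (∀ p q → p ≢ q → ¬ Related (lt M p) (lt M q)) → IsGeneric M
  generic {k} M countable ext prim distinct = (countable , ext) , λ A (n , A↔n) →
    let A′ = reorient s A
        f , f-pres = realise A′ n (Inverse.from A↔n) (from-injective A↔n)
    in preserves⇒embedding A M (f ∘ Inverse.to A↔n)
         (reorient-reflects s A M (f ∘ Inverse.to A↔n) λ p x y x<y → f-pres p _ _
           (subst₂ (lt A′ p) (sym (Inverse.strictlyInverseʳ A↔n x)) (sym (Inverse.strictlyInverseʳ A↔n y)) x<y))
    where
      from-injective : ∀ {X Y : Set} (f : X ↔ Y) → Injective _≡_ _≡_ (Inverse.from f)
      from-injective f {x} {y} eq =
        trans (sym (Inverse.strictlyInverseˡ f x)) (trans (cong (Inverse.to f) eq) (Inverse.strictlyInverseˡ f y))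
      x₀ = Inverse.from countable 0
      y₀ = Inverse.from countable 1
      x₀≢y₀ : x₀ ≢ y₀
      x₀≢y₀ x₀≡y₀ with from-injective countable x₀≡y₀
      ... | ()
      side : ∀ i → Σ (Fin 2) λ s → sgn s (lt M i) x₀ y₀
      side i = [ (λ u → zero , u) , (λ u → suc zero , u) ]′ (StrictLinear.≢⇒<> (linear M i) x₀≢y₀)
      s : Fin (suc k) → Fin 2
      s = proj₁ ∘ side
      M′ = reorient s M
      -- Without a discordant pair the reoriented orders coincide, so the original ones are equal or
      -- opposite.
      indep : ∀ {i j} → i ≢ j → Σ (Carrier M) λ x → Σ (Carrier M) λ y → lt M′ i x y × lt M′ j y x
      indep {i} {j} i≢j = byContradiction λ none →
        let i⇒j : ∀ x y → lt M′ i x y → lt M′ j x y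
            i⇒j x y x<y = [ id , (λ y<x → ⊥-elim (none (x , y , x<y , y<x))) ]′
              (StrictLinear.≢⇒<> (linear M′ j) (StrictLinear.<⇒≢ (linear M′ i) x<y))
            j⇒i : ∀ x y → lt M′ j x y → lt M′ i x y
            j⇒i x y x<y = [ id , (λ y<x → ⊥-elim (none (y , x , y<x , x<y))) ]′
              (StrictLinear.≢⇒<> (linear M′ i) (StrictLinear.<⇒≢ (linear M′ j) x<y))
        in distinct i j i≢j (Related-unsgn (s i) (s j) λ x y → mk⇔ (i⇒j x y) (j⇒i x y))
      open Independence M′ (extendible-reduct M id s (λ j → j , inj₁ (λ x y → mk⇔ id id)) ext)
        (invariantlyPrimitive-reduct M id s prim) x₀ y₀ (proj₂ ∘ side) indep using (realise)

theorem3p1 : (∀ (P : Set) → Dec P) →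
    (M : PermStr 3) → Homogeneous M → Primitive M →
    Σ ℕ λ m → 1 ≤ m ×
    Σ (Fin m → Fin 3) λ e →
    Injective _≡_ _≡_ e ×
    (∀ (j : Fin 3) → Σ (Fin m) λ p →
    SameRel (lt M j) (lt M (e p)) ⊎ OppositeRel (lt M j) (lt M (e p))) ×
    IsGeneric (reduct M e)
theorem3p1 lem M (countable , ext) prim with representatives lem (lt M)
... | zero , _ , _ , covers , _ = case proj₁ (covers zero) of λ ()
... | suc m , e , e-inj , covers , distinct =
  suc m , s≤s z≤n , e , e-inj , covers ,
  generic lem (reduct M e) countable
    -- With all signs `zero`, the reoriented reduct is the reduct itself.
    (extendible-reduct M e (λ _ → zero) covers ext)
    (invariantlyPrimitive-reduct M e (λ _ → zero) (invariantlyPrimitive lem M ext prim))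
    distinct
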